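{- There is a function $f\colon\mathbb{N}^3\to\mathbb{N}$ such that the following holds. Suppose $\mathcal{S}$ is a set system with semi-ladder index at most $\ell$, 2VC dimension at most $h$, and such that every induced subsystem of $\mathcal{S}$ has subchromatic number at most $s$, for some $\ell,h,s\in\mathbb{N}$. Then the strong odd chromatic number of $\mathcal{S}$ is at most $f(\ell,h,s)$.
   Context: A set system is a pair $\mathcal{S}=(U,\mathcal{F})$ with $U$ a finite set (the universe) and $\mathcal{F}$ a family of subsets of $U$. For $W\subseteq U$ and $\mathcal{Q}\subseteq\mathcal{F}$, the induced subsystem is $\mathcal{S}[W,\mathcal{Q}]=(W,\{F\cap W: F\in\mathcal{Q}\})$. The Gaifman graph $\mathsf{Gaif}(\mathcal{S})$ has vertex set $U$, with distinct $x,y$ adjacent iff some $F\in\mathcal{F}$ contains both. A coloring $\phi\colon U\to C$ (finite palette $C$) is strong odd if for every $F\in\mathcal{F}$ and every $i\in C$, the set $F\cap\phi^{ -1}(i)$ is empty or of odd size; the strong odd chromatic number of $\mathcal{S}$ is the minimum number of colors of a strong odd coloring. A semi-ladder of order $\ell$ consists of elements $u_1,\dots,u_\ell\in U$ and sets $F_1,\dots,F_\ell\in\mathcal{F}$ with $u_i\notin F_i$ for all $i$ and $u_i\in F_j$ whenever $i<j$; the semi-ladder index is the largest order of a semi-ladder in $\mathcal{S}$. A set $X\subseteq U$ is 2-shattered if for every two distinct $x,y\in X$ there is $F\in\mathcal{F}$ with $F\cap X=\{x,y\}$; the 2VC dimension is the largest size of a 2-shattered set. A cluster graph is a graph whose every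 connected component is a clique; a subcoloring of a graph $G$ is a map $\lambda\colon V(G)\to C$ such that $G[\lambda^{ -1}(i)]$ is a cluster graph for every $i\in C$; the subchromatic number of $G$ is the minimum number of colors of a subcoloring, and the subchromatic number of a set system is that of its Gaifman graph. -}

module Defs where

open import Data.Nat using (ℕ; _≤_; _<_; _%_)
open import Data.Fin using (Fin) renaming (_<_ to _<ᶠ_)
open import Data.Fin.Properties using (_≟_)
open import Data.Fin.Subset using (Subset; _∈_; _∉_; _∩_; ∣_∣)
open import Data.Vec using (tabulate)
open import Data.Product using (Σ; ∃; _×_)
open import Data.Sum using (_⊎_)
open import Relation.Nullary using (¬_)
open import Relation.Nullary.Decidable using (⌊_⌋)
open import Relation.Binary.PropositionalEquality using (_≡_; _≢_)

record SetSystem : Set where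
  constructor setSystem
  field
    n    : ℕ
    m    : ℕ
    sets : Fin m → Subset n
open SetSystem public

-- A graph on a vertex set V ⊆ Fin n, given by an adjacency relation
-- (only its restriction to V is relevant).
record Graph (n : ℕ) : Set₁ where
  constructor graph
  field
    V   : Subset n
    Adj : Fin n → Fin n → Set
open Graph public

induced : ∀ {n} → Graph n → Subset n → Graph n
induced G A = graph (V G ∩ A) (Adj G)

data Connected {n : ℕ} (G : Graph n) : Fin n → Fin n → Set where
  here : ∀ {x} → x ∈ V G → Connected G x x
  step : ∀ {x y z} → x ∈ V G → Adj G x y → Connected G y z → Connected G x z

IsClusterGraph : ∀ {n} → Graph n → Set
IsClusterGraph {n} G = ∀ (x y : Fin n) → Connected G x y → x ≢ y → Adj G x y

colourClass : ∀ {n c} → (Fin n → Fin c) → Fin c → Subset n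
colourClass φ i = tabulate (λ x → ⌊ φ x ≟ i ⌋)

IsSubcoloring : ∀ {n c} → Graph n → (Fin n → Fin c) → Set
IsSubcoloring {c = c} G λ' = ∀ (i : Fin c) → IsClusterGraph (induced G (colourClass λ' i))

SubchromaticAtMost : ∀ {n} → Graph n → ℕ → Set
SubchromaticAtMost {n} G s = Σ (Fin n → Fin s) λ λ' → IsSubcoloring G λ'

GaifmanInduced : (S : SetSystem) → Subset (n S) → Subset (m S) → Graph (n S)
GaifmanInduced S W Q =
  graph W (λ x y → x ≢ y × ∃ λ j → j ∈ Q × x ∈ (sets S j ∩ W) × y ∈ (sets S j ∩ W))

HereditarySubchromaticAtMost : SetSystem → ℕ → Set
HereditarySubchromaticAtMost S s =
  ∀ (W : Subset (n S)) (Q : Subset (m S)) → SubchromaticAtMost (GaifmanInduced S W Q) s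

IsSemiLadder : (S : SetSystem) (k : ℕ) → (Fin k → Fin (n S)) → (Fin k → Fin (m S)) → Set
IsSemiLadder S k u F =
  (∀ i → u i ∉ sets S (F i)) × (∀ i j → i <ᶠ j → u i ∈ sets S (F j))

SemiLadderIndexAtMost : SetSystem → ℕ → Set
SemiLadderIndexAtMost S ℓ =
  ∀ (k : ℕ) (u : Fin k → Fin (n S)) (F : Fin k → Fin (m S)) → IsSemiLadder S k u F → k ≤ ℓ

TwoShattered : (S : SetSystem) → Subset (n S) → Set
TwoShattered S X =
  ∀ x y → x ∈ X → y ∈ X → x ≢ y →
    ∃ λ j → ∀ z → (z ∈ (sets S j ∩ X) → (z ≡ x ⊎ z ≡ y)) × ((z ≡ x ⊎ z ≡ y) → z ∈ (sets S j ∩ X))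

TwoVCAtMost : SetSystem → ℕ → Set
TwoVCAtMost S h = ∀ (X : Subset (n S)) → TwoShattered S X → ∣ X ∣ ≤ h

IsStrongOddColoring : (S : SetSystem) {c : ℕ} → (Fin (n S) → Fin c) → Set
IsStrongOddColoring S {c} φ =
  ∀ (j : Fin (m S)) (i : Fin c) →
    ∣ sets S j ∩ colourClass φ i ∣ ≡ 0 ⊎ ∣ sets S j ∩ colourClass φ i ∣ % 2 ≡ 1

StrongOddChromaticAtMost : SetSystem → ℕ → Set
StrongOddChromaticAtMost S c = Σ (Fin (n S) → Fin c) λ φ → IsStrongOddColoring S φ

{-# OPTIONS --safe #-}
module Submission where

-- By induction on ℓ, every W ⊆ U on which the semi-ladder index is at most ℓ has a strong odd
-- colouring with g ℓ colours.  Call a set proper if it does not contain W, and subcolour the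
-- Gaifman graph that the proper sets induce on W.  A clique K of this subcolouring is covered by
-- boundedly many proper sets: otherwise K contains a long sequence in which every element avoids
-- the sets chosen for the earlier pairs, and Ramsey's theorem for triples extracts from it a long
-- semi-ladder or a large 2-shattered set.  Inside a proper set the semi-ladder index drops, so
-- the parts of K are coloured by induction.  Now each proper set meets a colour class inside a
-- single clique, oddly, and each clique meets each colour class oddly.  The sets containing W are
-- repaired by splitting one clique off every colour class of even size.

open import Defs
open import Data.Bool using (Bool; true; false; not; _∧_; _xor_; if_then_else_)
open import Data.Bool.Properties using (¬-not) renaming (_≟_ to _≟ᵇ_)
open import Data.Fin using (Fin; zero; suc; opposite; combine; remQuot) renaming (_<_ to _<ᶠ_)
open import Data.Fin.Properties using (_≟_; any?; suc-injective; combine-injective; opposite-prop; toℕ<n; remQuot-combine)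
open import Data.Fin.Subset using (Subset; Nonempty; ⁅_⁆; _∩_; _∪_; ∣_∣) renaming (_∈_ to _∈ˢ_; ⊥ to ∅)
open import Data.Fin.Subset.Properties using (_∈?_; x∈p∩q⁺; x∈p∩q⁻; x∈p∪q⁺; x∈p∪q⁻; x∈⁅x⁆; x∈⁅y⁆⇒x≡y; ∉⊥; p⊂q⇒∣p∣<∣q∣; Empty-unique; ∣⊥∣≡0; nonempty?)
open import Data.List using (List; []; _∷_; _++_; length; lookup; tabulate; initLast; _∷ʳ′_)
open import Data.List.Membership.Propositional using (_∈_)
open import Data.List.Membership.Propositional.Properties using (∈-tabulate⁻; ∈-lookup)
open import Data.List.Properties using (length-++; length-tabulate)
open import Data.List.Relation.Binary.Sublist.Propositional using (_⊆_; []; _∷_; _∷ʳ_; ⊆-refl; ⊆-trans; from∈; to∈; minimum)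
import Data.List.Relation.Binary.Sublist.Propositional as Sublist
open import Data.List.Relation.Binary.Sublist.Propositional.Properties using (++⁺)
open import Data.List.Relation.Unary.All as All using (All; []; _∷_)
open import Data.List.Relation.Unary.AllPairs using (AllPairs; []; _∷_)
open import Data.List.Relation.Unary.Any using (here; there)
open import Data.List.Relation.Unary.Unique.Propositional using (Unique)
open import Data.Maybe using (Maybe; just; nothing; fromMaybe) renaming (map to mapᵐ)
open import Data.Nat using (ℕ; zero; suc; _+_; _*_; _≤_; _%_; z≤n; s≤s)
open import Data.Nat.Properties using (≤-trans; ≤-reflexive; ≤-pred; 1+n≰n; m≤m+n; m≤n+m; +-comm; ∸-monoʳ-<)
open import Data.Product using (Σ; ∃; ∃₂; _×_; _,_; proj₁; proj₂; uncurry)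
open import Data.Sum using (_⊎_; inj₁; inj₂; [_,_]′)
open import Data.Unit using (⊤; tt)
open import Data.Vec as Vec using (Vec; []; _∷_; toList)
import Data.Vec.Functional as Vector
open import Data.Vec.Properties using ([]=⇒lookup; lookup⇒[]=; lookup∘tabulate; tabulate-cong)
open import Function using (_∘_; mk⇔)
open import Relation.Binary.PropositionalEquality using (_≡_; _≢_; refl; sym; trans; cong; cong₂; subst)
open import Relation.Nullary using (¬_; Dec; yes; no; does; contradiction)
open import Relation.Nullary.Decidable using (_×-dec_; _⊎-dec_; ¬?; does-⇔; dec-true; isYes≗does; decidable-stable)
open import Relation.Unary using (Decidable)

does-true : ∀ {P : Set} (P? : Dec P) → does P? ≡ true → P
does-true (yes p) _ = p

does-false : ∀ {P : Set} (P? : Dec P) → does P? ≡ false → ¬ P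
does-false (no ¬p) _ = ¬p

-- Parity

parity : ∀ {n} → (Fin n → Bool) → Bool
parity {zero}  f = false
parity {suc n} f = f zero xor parity (f ∘ suc)

parity-cong : ∀ {n} {f g : Fin n → Bool} → (∀ x → f x ≡ g x) → parity f ≡ parity g
parity-cong {zero}  f≗g = refl
parity-cong {suc n} f≗g = cong₂ _xor_ (f≗g zero) (parity-cong (f≗g ∘ suc))

parity-false : ∀ n → parity {n} (λ _ → false) ≡ false
parity-false zero    = refl
parity-false (suc n) = parity-false n

xor-interchange : ∀ a b c d → (a xor b) xor (c xor d) ≡ (a xor c) xor (b xor d)
xor-interchange true  true  true  d = refl
xor-interchange true  true  false true = refl
xor-interchange true  true  false false = refl
xor-interchange true  false true  true = refl
xor-interchange true  false true  false = refl
xor-interchange true  false false d = refl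
xor-interchange false true  true  true = refl
xor-interchange false true  true  false = refl
xor-interchange false true  false d = refl
xor-interchange false false c d = refl

parity-xor : ∀ {n} (f g : Fin n → Bool) → parity (λ x → f x xor g x) ≡ parity f xor parity g
parity-xor {zero}  f g = refl
parity-xor {suc n} f g =
  trans (cong ((f zero xor g zero) xor_) (parity-xor (f ∘ suc) (g ∘ suc)))
        (xor-interchange (f zero) (g zero) (parity (f ∘ suc)) (parity (g ∘ suc)))

parity-singleton : ∀ {n} (x : Fin n) → parity (λ y → does (y ≟ x)) ≡ true
parity-singleton {suc n} zero    = cong not (parity-false n)
parity-singleton {suc n} (suc x) =
  trans (parity-cong {f = λ y → does (suc y ≟ suc x)} {g = λ y → does (y ≟ x)}
           λ y → does-⇔ (mk⇔ suc-injective (cong suc)) (suc y ≟ suc x) (y ≟ x))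
        (parity-singleton x)

-- A record rather than a bare equation, so that unification can recover the predicate and its
-- decision procedure from the type.
record Odd {n : ℕ} {P : Fin n → Set} (P? : Decidable P) : Set where
  constructor odd
  field parity-true : parity (does ∘ P?) ≡ true
open Odd

module _ {n : ℕ} {P Q : Fin n → Set} (P? : Decidable P) (Q? : Decidable Q) where

  Odd-resp : (∀ y → P y → Q y) → (∀ y → Q y → P y) → Odd P? → Odd Q?
  Odd-resp to from (odd p) = odd (trans (sym (parity-cong λ y → does-⇔ (mk⇔ (to y) (from y)) (P? y) (Q? y))) p)

  -- Parity is additive when `P` is split along `Q`; an even total forces the two halves to have
  -- equal parity.
  Odd-complement : ¬ Odd P? → Odd (λ y → P? y ×-dec Q? y) → Odd (λ y → P? y ×-dec ¬? (Q? y))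
  Odd-complement even (odd p) =
    odd (lemma (trans (sym (parity-xor f g)) (parity-cong split)) p (¬-not (even ∘ odd)))
    where
    f g : Fin n → Bool
    f y = does (P? y ×-dec Q? y)
    g y = does (P? y ×-dec ¬? (Q? y))
    bool : ∀ p q → (p ∧ q) xor (p ∧ not q) ≡ p
    bool true  true  = refl
    bool true  false = refl
    bool false q     = refl
    split : ∀ y → f y xor g y ≡ does (P? y)
    split y = bool (does (P? y)) (does (Q? y))
    lemma : ∀ {a b c} → a xor b ≡ c → a ≡ true → c ≡ false → b ≡ true
    lemma {b = true} _ _ _ = refl
    lemma {b = false} refl refl ()

Odd-singleton : ∀ {n} {P : Fin n → Set} (P? : Decidable P) (x : Fin n) →
  P x → (∀ y → P y → y ≡ x) → Odd P?
Odd-singleton P? x Px uniq = Odd-resp (_≟ x) P? (λ { y refl → Px }) uniq (odd (parity-singleton x))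

-- Equivalence classes

first : ∀ {n} → (Fin n → Bool) → Maybe (Fin n)
first {zero}  f = nothing
first {suc n} f = if f zero then just zero else mapᵐ suc (first (f ∘ suc))

first-cong : ∀ {n} {f g : Fin n → Bool} → (∀ x → f x ≡ g x) → first f ≡ first g
first-cong {zero}  f≗g = refl
first-cong {suc n} {f} {g} f≗g rewrite f≗g zero | first-cong (f≗g ∘ suc) = refl

first-just : ∀ {n} (f : Fin n → Bool) x → f x ≡ true → ∃ λ y → first f ≡ just y × f y ≡ true
first-just {suc n} f x fx with f zero in eq
... | true = zero , refl , eq
first-just {suc n} f zero fx | false = contradiction (trans (sym eq) fx) λ ()
first-just {suc n} f (suc x) fx | false with first-just (f ∘ suc) x fx
... | y , p , fy = suc y , cong (mapᵐ suc) p , fy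

mark : ∀ {A : Set} → Dec A → Fin 2
mark (yes _) = suc zero
mark (no _)  = zero

mark-cong : ∀ {A B : Set} → (A → B) → (B → A) → (a? : Dec A) (b? : Dec B) → mark a? ≡ mark b?
mark-cong f g (yes a) (yes b) = refl
mark-cong f g (yes a) (no ¬b) = contradiction (f a) ¬b
mark-cong f g (no ¬a) (yes b) = contradiction (g b) ¬a
mark-cong f g (no ¬a) (no ¬b) = refl

mark-reflects : ∀ {A B : Set} (a? : Dec A) (b? : Dec B) → mark a? ≡ mark b? → A → B
mark-reflects (yes _) (yes b) _ _ = b
mark-reflects (no ¬a) _       _ a = contradiction a ¬a

module Classes {n : ℕ} {R : Fin n → Fin n → Set} (R? : ∀ x y → Dec (R x y))
  (R-refl : ∀ {x} → R x x) (R-sym : ∀ {x y} → R x y → R y x)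
  (R-trans : ∀ {x y z} → R x y → R y z → R x z) where

  -- The first related element is a canonical choice. The default `x` never occurs, by reflexivity.
  rep : Fin n → Fin n
  rep x = fromMaybe x (first (does ∘ R? x))

  rep-related : ∀ x → R x (rep x)
  rep-related x with first-just (does ∘ R? x) x (dec-true (R? x x) R-refl)
  ... | y , p , Rxy rewrite p with R? x y
  ...   | yes r = r

  -- Related elements have pointwise equal rows of `R?`, so both searches return the same element.
  -- Success of the search is established first because the two defaults differ.
  rep-cong : ∀ {x y} → R x y → rep x ≡ rep y
  rep-cong {x} {y} Rxy with first-just (does ∘ R? x) x (dec-true (R? x x) R-refl)
  ... | z , p , _
    rewrite sym (first-cong {f = does ∘ R? x} {g = does ∘ R? y}
              λ w → does-⇔ (mk⇔ (R-trans (R-sym Rxy)) (R-trans Rxy)) (R? x w) (R? y w))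
          | p = refl

  module _ {W : Fin n → Set} (W? : Decidable W) {c : ℕ} (χ : Fin n → Fin c)
    (odd-class : ∀ x → W x → Odd (λ y → W? y ×-dec ((χ y ≟ χ x) ×-dec R? x y))) where

    -- When colour `i` is even on `W`, the `R`-class of one of its elements is separated: its part
    -- in the colour is odd, so the rest is odd as well. The marking is constant on `R`-classes and
    -- so cuts none of them.
    splitColour : ∀ i → Σ (Fin n → Fin 2) λ σ → (∀ {x y} → R x y → σ x ≡ σ y) ×
      (∀ x → W x → χ x ≡ i → Odd (λ y → W? y ×-dec ((χ y ≟ i) ×-dec (σ y ≟ σ x))))
    splitColour i with any? (λ z → W? z ×-dec (χ z ≟ i))
    ... | no none = (λ _ → zero) , (λ _ → refl) , λ x Wx e → contradiction (x , Wx , e) none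
    ... | yes (z , Wz , refl) with parity (λ y → does (W? y ×-dec (χ y ≟ χ z))) ≟ᵇ true
    ...   | yes all-odd = (λ _ → zero) , (λ _ → refl) , λ x Wx e →
              Odd-resp (λ y → W? y ×-dec (χ y ≟ χ z)) _ (λ y (Wy , e) → Wy , e , refl)
                       (λ y (Wy , e , _) → Wy , e) (odd all-odd)
    ...   | no all-even = σ , (λ r → mark-cong (λ s → R-trans s r) (λ s → R-trans s (R-sym r)) _ _) ,
              λ x Wx e → by-side x (R? z x)
      where
      σ : Fin n → Fin 2
      σ y = mark (R? z y)
      class? : Decidable (λ y → W y × χ y ≡ χ z)
      class? y = W? y ×-dec (χ y ≟ χ z)
      odd-in : Odd (λ y → class? y ×-dec R? z y)
      odd-in = Odd-resp (λ y → W? y ×-dec ((χ y ≟ χ z) ×-dec R? z y)) _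
        (λ y (Wy , e , r) → (Wy , e) , r) (λ y ((Wy , e) , r) → Wy , e , r) (odd-class z Wz)
      by-side : ∀ x → Dec (R z x) → Odd (λ y → W? y ×-dec ((χ y ≟ χ z) ×-dec (σ y ≟ σ x)))
      by-side x (yes Rzx) = Odd-resp (λ y → class? y ×-dec R? z y) _
        (λ y ((Wy , e) , r) → Wy , e , mark-cong (λ _ → Rzx) (λ _ → r) (R? z y) (R? z x))
        (λ y (Wy , e , eq) → (Wy , e) , mark-reflects (R? z x) (R? z y) (sym eq) Rzx)
        odd-in
      by-side x (no ¬Rzx) = Odd-resp (λ y → class? y ×-dec ¬? (R? z y)) _
        (λ y ((Wy , e) , ¬r) → Wy , e ,
          mark-cong (λ r → contradiction r ¬r) (λ r → contradiction r ¬Rzx) (R? z y) (R? z x))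
        (λ y (Wy , e , eq) → (Wy , e) , λ r → ¬Rzx (mark-reflects (R? z y) (R? z x) eq r))
        (Odd-complement class? (R? z) (all-even ∘ parity-true) odd-in)

    -- The splittings of the separate colours are glued: each element follows the one made for its
    -- own colour.
    splitColours : Σ (Fin n → Fin 2) λ σ → (∀ {x y} → χ x ≡ χ y → R x y → σ x ≡ σ y) ×
      (∀ x → W x → Odd (λ y → W? y ×-dec ((χ y ≟ χ x) ×-dec (σ y ≟ σ x))))
    splitColours = σ , invariant , λ x Wx →
      Odd-resp (λ y → W? y ×-dec ((χ y ≟ χ x) ×-dec (proj₁ (splitColour (χ x)) y ≟ σ x))) _
        (λ y (Wy , e , eq) → Wy , e , trans (cong (λ i → proj₁ (splitColour i) y) e) eq)
        (λ y (Wy , e , eq) → Wy , e , trans (cong (λ i → proj₁ (splitColour i) y) (sym e)) eq)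
        (proj₂ (proj₂ (splitColour (χ x))) x Wx refl)
      where
      σ : Fin n → Fin 2
      σ x = proj₁ (splitColour (χ x)) x
      invariant : ∀ {x y} → χ x ≡ χ y → R x y → σ x ≡ σ y
      invariant {x} {y} e r = trans (cong (λ i → proj₁ (splitColour i) x) e)
                                    (proj₁ (proj₂ (splitColour (χ y))) r)

-- Ramsey's theorem for k-element subsequences

-- The head of the list induces a colouring of `k`-tuples of the tail. A homogeneous subsequence for
-- it must be long enough to continue inside it with one target lowered by one. For `k = 0` there is
-- only one tuple, and `p + q` merely dominates both targets.
ramseyBound : ℕ → ℕ → ℕ → ℕ
ramseyBound zero    p       q       = p + q
ramseyBound (suc k) zero    q       = 0
ramseyBound (suc k) (suc p) zero    = 0
ramseyBound (suc k) (suc p) (suc q) =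
  suc (ramseyBound k (ramseyBound (suc k) p (suc q)) (ramseyBound (suc k) (suc p) q))

module _ {A : Set} where

  Homogeneous : ∀ {k} → (Vec A k → Bool) → Bool → List A → Set
  Homogeneous c b xs = ∀ v → toList v ⊆ xs → c v ≡ b

  Homogeneous-[] : ∀ {k} (c : Vec A (suc k) → Bool) b → Homogeneous c b []
  Homogeneous-[] c b (x ∷ v) ()

  Homogeneous-∷ : ∀ {k} (c : Vec A (suc k) → Bool) b {a ys zs} →
    Homogeneous (c ∘ (a ∷_)) b ys → zs ⊆ ys → Homogeneous c b zs → Homogeneous c b (a ∷ zs)
  Homogeneous-∷ c b ha zs⊆ys hz (x ∷ v) (_ ∷ʳ s)   = hz (x ∷ v) s
  Homogeneous-∷ c b ha zs⊆ys hz (x ∷ v) (refl ∷ s) = ha v (⊆-trans s zs⊆ys)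

  RamseyFor : ∀ {k} → ℕ → ℕ → (Vec A k → Bool) → List A → Set
  RamseyFor p q c xs = ∃ λ ys → ys ⊆ xs ×
    (p ≤ length ys × Homogeneous c true ys ⊎ q ≤ length ys × Homogeneous c false ys)

  -- All tuples that start with `a` and continue in `ys` have one colour. A homogeneous subsequence
  -- of `ys` in that colour can be extended by `a`; one in the other colour already has the full
  -- length.
  ramsey-∷ : ∀ {k p q p′ q′} (c : Vec A (suc k) → Bool) a as → RamseyFor p′ q′ (c ∘ (a ∷_)) as →
    (∀ ys → p′ ≤ length ys → RamseyFor p (suc q) c ys) →
    (∀ ys → q′ ≤ length ys → RamseyFor (suc p) q c ys) →
    RamseyFor (suc p) (suc q) c (a ∷ as)
  ramsey-∷ c a as (ys , ys⊆as , inj₁ (len , hy)) left right with left ys len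
  ... | zs , zs⊆ys , inj₁ (len′ , hz) =
          a ∷ zs , refl ∷ ⊆-trans zs⊆ys ys⊆as , inj₁ (s≤s len′ , Homogeneous-∷ c true hy zs⊆ys hz)
  ... | zs , zs⊆ys , inj₂ r = zs , a ∷ʳ ⊆-trans zs⊆ys ys⊆as , inj₂ r
  ramsey-∷ c a as (ys , ys⊆as , inj₂ (len , hy)) left right with right ys len
  ... | zs , zs⊆ys , inj₁ r = zs , a ∷ʳ ⊆-trans zs⊆ys ys⊆as , inj₁ r
  ... | zs , zs⊆ys , inj₂ (len′ , hz) =
          a ∷ zs , refl ∷ ⊆-trans zs⊆ys ys⊆as , inj₂ (s≤s len′ , Homogeneous-∷ c false hy zs⊆ys hz)

  ramsey : ∀ k p q (c : Vec A k → Bool) xs → ramseyBound k p q ≤ length xs → RamseyFor p q c xs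
  ramsey zero p q c xs le with c [] in eq
  ... | true  = xs , ⊆-refl , inj₁ (≤-trans (m≤m+n p q) le , λ { [] _ → eq })
  ... | false = xs , ⊆-refl , inj₂ (≤-trans (m≤n+m q p) le , λ { [] _ → eq })
  ramsey (suc k) zero    q    c xs le = [] , minimum xs , inj₁ (z≤n , Homogeneous-[] c true)
  ramsey (suc k) (suc p) zero c xs le = [] , minimum xs , inj₂ (z≤n , Homogeneous-[] c false)
  ramsey (suc k) (suc p) (suc q) c (a ∷ as) (s≤s le) =
    ramsey-∷ c a as (ramsey k _ _ (c ∘ (a ∷_)) as le)
      (ramsey (suc k) p (suc q) c) (ramsey (suc k) (suc p) q c)

  -- The three positions of a third element are the three kinds of triple that `shattered` has to
  -- exclude.
  insert-pair : ∀ {a b z} {ys : List A} → a ∷ b ∷ [] ⊆ ys → z ∈ ys →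
    (z ≡ a ⊎ z ≡ b) ⊎ z ∷ a ∷ b ∷ [] ⊆ ys ⊎ a ∷ z ∷ b ∷ [] ⊆ ys ⊎ a ∷ b ∷ z ∷ [] ⊆ ys
  insert-pair (_ ∷ʳ s)    (here refl) = inj₂ (inj₁ (refl ∷ s))
  insert-pair (y ∷ʳ s)    (there z∈) with insert-pair s z∈
  ... | inj₁ e               = inj₁ e
  ... | inj₂ (inj₁ t)        = inj₂ (inj₁ (y ∷ʳ t))
  ... | inj₂ (inj₂ (inj₁ t)) = inj₂ (inj₂ (inj₁ (y ∷ʳ t)))
  ... | inj₂ (inj₂ (inj₂ t)) = inj₂ (inj₂ (inj₂ (y ∷ʳ t)))
  insert-pair (refl ∷ s)  (here refl) = inj₁ (inj₁ refl)
  insert-pair (refl ∷ s)  (there z∈) with insert-element s z∈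
    where
    insert-element : ∀ {b z} {ys : List A} → b ∷ [] ⊆ ys → z ∈ ys →
      z ≡ b ⊎ z ∷ b ∷ [] ⊆ ys ⊎ b ∷ z ∷ [] ⊆ ys
    insert-element (_ ∷ʳ s)   (here refl) = inj₂ (inj₁ (refl ∷ s))
    insert-element (y ∷ʳ s)   (there z∈) with insert-element s z∈
    ... | inj₁ e        = inj₁ e
    ... | inj₂ (inj₁ t) = inj₂ (inj₁ (y ∷ʳ t))
    ... | inj₂ (inj₂ t) = inj₂ (inj₂ (y ∷ʳ t))
    insert-element (refl ∷ s) (here refl) = inj₁ refl
    insert-element (refl ∷ s) (there z∈)  = inj₂ (inj₂ (refl ∷ from∈ z∈))
  ... | inj₁ e        = inj₁ (inj₂ e)
  ... | inj₂ (inj₁ t) = inj₂ (inj₂ (inj₁ (refl ∷ t)))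
  ... | inj₂ (inj₂ t) = inj₂ (inj₂ (inj₂ (refl ∷ t)))

  pair-sublist : ∀ {a b} {ys : List A} → a ∈ ys → b ∈ ys → a ≢ b → a ∷ b ∷ [] ⊆ ys ⊎ b ∷ a ∷ [] ⊆ ys
  pair-sublist (here refl) (here refl) a≢b = contradiction refl a≢b
  pair-sublist (here refl) (there b∈)  a≢b = inj₁ (refl ∷ from∈ b∈)
  pair-sublist (there a∈)  (here refl) a≢b = inj₂ (refl ∷ from∈ a∈)
  pair-sublist (there a∈)  (there b∈)  a≢b with pair-sublist a∈ b∈ a≢b
  ... | inj₁ s = inj₁ (_ ∷ʳ s)
  ... | inj₂ s = inj₂ (_ ∷ʳ s)

-- Set systems as decidable incidence relations

-- Two applications of Ramsey's theorem to triples. A rung consumes three elements, and `suc ℓ`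
-- rungs are one too many. The additional `suc` in the inner bound pays for an oldest element that
-- is set aside.
genericLength : ℕ → ℕ → ℕ
genericLength ℓ h = ramseyBound 3 (suc ℓ * 3) (ramseyBound 3 (suc (suc ℓ * 3)) (suc h))

-- One covering set for each ordered pair of chosen elements.
coverSize : ℕ → ℕ → ℕ
coverSize ℓ h = genericLength ℓ h * genericLength ℓ h

-- The factors count the subcolouring, the colours inside a clique (a part with an inductive colour,
-- or the colour of an isolated element) and the final splitting in two.
palette : ℕ → ℕ → ℕ → ℕ
palette M s zero    = 2
palette M s (suc ℓ) = s * suc (M * palette M s ℓ) * 2

module System {n m : ℕ} {E : Fin m → Fin n → Set} (E? : ∀ j x → Dec (E j x)) where

  -- Listed from the last rung to the first.
  Ladder : List (Fin n × Fin m) → Set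
  Ladder L = All (λ (u , j) → ¬ E j u) L × AllPairs (λ (_ , j) (u , _) → E j u) L

  LadderBound : (Fin n → Set) → ℕ → Set
  LadderBound W ℓ = ∀ L → All (W ∘ proj₁) L → Ladder L → length L ≤ ℓ

  Shattered : List (Fin n) → Set
  Shattered xs = ∀ {x y} → x ∈ xs → y ∈ xs → x ≢ y →
    ∃ λ j → E j x × E j y × (∀ {z} → z ∈ xs → E j z → z ≡ x ⊎ z ≡ y)

  ShatteredBound : ℕ → Set
  ShatteredBound h = ∀ xs → Unique xs → Shattered xs → length xs ≤ h

  -- A cluster graph is encoded by transitivity of adjacency within a colour class. The elements may
  -- coincide.
  ClusterBound : ℕ → Set₁
  ClusterBound s = ∀ {W : Fin n → Set} {Q : Fin m → Set} → Decidable W → Decidable Q →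
    Σ (Fin n → Fin s) λ κ → ∀ {x y z} → W x → W y → W z → κ x ≡ κ y → κ y ≡ κ z →
      (∃ λ j → Q j × E j x × E j y) → (∃ λ j → Q j × E j y × E j z) → ∃ λ j → Q j × E j x × E j z

  -- Generic sequences are short

  -- Sequences are listed from the newest element to the oldest one; F is applied to an older and
  -- a newer element, in this order.
  module Generic (F : Fin n → Fin n → Fin m) where

    Avoiding : List (Fin n) → Set
    Avoiding xs = ∀ {x y z} → z ∷ y ∷ x ∷ [] ⊆ xs → ¬ E (F x y) z

    Distinct : List (Fin n) → Set
    Distinct xs = ∀ {x y} → y ∷ x ∷ [] ⊆ xs → y ≢ x

    Distinct⇒Unique : ∀ xs → Distinct xs → Unique xs
    Distinct⇒Unique []       d = []
    Distinct⇒Unique (x ∷ xs) d =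
      All.tabulate (λ y∈ → d (refl ∷ from∈ y∈)) ∷ Distinct⇒Unique xs (d ∘ (x ∷ʳ_))

    -- Disjoint blocks of three: the set of a rung is built from elements older than its own element
    -- `a` and newer than the elements of all rungs further down the list.
    rungs : (Fin n → Fin n → Fin m) → List (Fin n) → List (Fin n × Fin m)
    rungs G (a ∷ b ∷ c ∷ xs) = (a , G b c) ∷ rungs G xs
    rungs G _                = []

    rungs-length : ∀ G k xs → k * 3 ≤ length xs → k ≤ length (rungs G xs)
    rungs-length G zero    xs               _                  = z≤n
    rungs-length G (suc k) (a ∷ b ∷ c ∷ xs) (s≤s (s≤s (s≤s le))) = s≤s (rungs-length G k xs le)

    rungs-All : ∀ G {P : Fin n → Set} xs → All P xs → All (P ∘ proj₁) (rungs G xs)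
    rungs-All G []                _                     = []
    rungs-All G (_ ∷ [])          _                     = []
    rungs-All G (_ ∷ _ ∷ [])      _                     = []
    rungs-All G (a ∷ b ∷ c ∷ xs) (pa ∷ _ ∷ _ ∷ pxs) = pa ∷ rungs-All G xs pxs

    rungs-Ladder : ∀ G xs → (∀ {a b c} → a ∷ b ∷ c ∷ [] ⊆ xs → ¬ E (G b c) a) →
      (∀ {b c y} → b ∷ c ∷ y ∷ [] ⊆ xs → E (G b c) y) → Ladder (rungs G xs)
    rungs-Ladder G []               out inn = [] , []
    rungs-Ladder G (_ ∷ [])         out inn = [] , []
    rungs-Ladder G (_ ∷ _ ∷ [])     out inn = [] , []
    rungs-Ladder G (a ∷ b ∷ c ∷ xs) out inn
      with rungs-Ladder G xs (λ s → out (a ∷ʳ b ∷ʳ c ∷ʳ s)) (λ s → inn (a ∷ʳ b ∷ʳ c ∷ʳ s))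
    ... | outs , inns =
      out (refl ∷ refl ∷ refl ∷ minimum xs) ∷ outs ,
      rungs-All G xs (All.tabulate λ y∈ → inn (a ∷ʳ refl ∷ refl ∷ from∈ y∈)) ∷ inns

    no-long-ladder : ∀ {ℓ} → LadderBound (λ _ → ⊤) ℓ → ∀ G xs → suc ℓ * 3 ≤ length xs →
      (∀ {a b c} → a ∷ b ∷ c ∷ [] ⊆ xs → ¬ E (G b c) a) →
      ¬ (∀ {b c y} → b ∷ c ∷ y ∷ [] ⊆ xs → E (G b c) y)
    no-long-ladder {ℓ} ladders G xs len out inn = 1+n≰n (≤-trans (rungs-length G (suc ℓ) xs len)
      (ladders (rungs G xs) (All.tabulate λ _ → tt) (rungs-Ladder G xs out inn)))

    -- The set that `F` assigns to a pair cuts out exactly that pair: a third element is newer than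
    -- both, older than both or between them, and one hypothesis excludes each position.
    shattered : ∀ xs → Avoiding xs →
      (∀ {x y} → x ∈ xs → y ∈ xs → E (F x y) x × E (F x y) y) →
      (∀ {x y z} → z ∷ y ∷ x ∷ [] ⊆ xs → ¬ E (F y z) x) →
      (∀ {x y z} → z ∷ y ∷ x ∷ [] ⊆ xs → ¬ E (F x z) y) → Shattered xs
    shattered xs avoid F∋ oldest middle x∈ y∈ x≢y =
      [ (λ s → F _ _ , proj₂ (F∋ y∈ x∈) , proj₁ (F∋ y∈ x∈) , λ {z} → only s)
      , (λ s → F _ _ , proj₁ (F∋ x∈ y∈) , proj₂ (F∋ x∈ y∈) ,
               λ {z} z∈ e → [ inj₂ , inj₁ ]′ (only s z∈ e))
      ]′ (pair-sublist x∈ y∈ x≢y)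
      where
      only : ∀ {a b z} → a ∷ b ∷ [] ⊆ xs → z ∈ xs → E (F b a) z → z ≡ a ⊎ z ≡ b
      only s z∈ e with insert-pair s z∈
      ... | inj₁ eq              = eq
      ... | inj₂ (inj₁ t)        = contradiction e (avoid t)
      ... | inj₂ (inj₂ (inj₁ t)) = contradiction e (middle t)
      ... | inj₂ (inj₂ (inj₂ t)) = contradiction e (oldest t)

    generic-short : ∀ {ℓ h} → LadderBound (λ _ → ⊤) ℓ → ShatteredBound h →
      ∀ xs → Avoiding xs → Distinct xs →
      (∀ {x y} → x ∈ xs → y ∈ xs → E (F x y) x × E (F x y) y) →
      ¬ genericLength ℓ h ≤ length xs
    generic-short {ℓ} {h} ladders shatters xs avoid distinct F∋ long
      -- First colouring: does the set of the two newer elements of a triple contain the oldest one?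
      -- If always, these sets form a ladder, because newer elements avoid them.
      with ramsey 3 (suc ℓ * 3) _ (λ { (z ∷ y ∷ x ∷ []) → does (E? (F y z) x) }) xs long
    ... | ys , ys⊆xs , inj₁ (len , hom) =
      no-long-ladder ladders (λ b c → F c b) ys len (λ s → avoid (⊆-trans s ys⊆xs))
        λ {b} {c} {y} s → does-true (E? (F c b) y) (hom (b ∷ c ∷ y ∷ []) s)
    ... | ys , ys⊆xs , inj₂ (len , hom₁)
      -- Second colouring: does the set of the two outer elements contain the middle one? If never,
      -- the sequence is 2-shattered.
      with ramsey 3 (suc (suc ℓ * 3)) (suc h) (λ { (z ∷ y ∷ x ∷ []) → does (E? (F x z) y) }) ys len
    ...   | zs , zs⊆ys , inj₂ (len′ , hom₂) =
      1+n≰n (≤-trans len′ (shatters zs (Distinct⇒Unique zs (distinct ∘ up))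
        (shattered zs (avoid ∘ up) (λ x∈ y∈ → F∋ (Sublist.lookup zs⊆xs x∈) (Sublist.lookup zs⊆xs y∈))
          (λ {x} {y} {z} s → does-false (E? (F y z) x) (hom₁ (z ∷ y ∷ x ∷ []) (⊆-trans s zs⊆ys)))
          (λ {x} {y} {z} s → does-false (E? (F x z) y) (hom₂ (z ∷ y ∷ x ∷ []) s)))))
      where
      zs⊆xs : zs ⊆ xs
      zs⊆xs = ⊆-trans zs⊆ys ys⊆xs
      up : ∀ {us} → us ⊆ zs → us ⊆ xs
      up s = ⊆-trans s zs⊆xs
    -- With the oldest element `o` fixed, `F o b` contains everything between `o` and `b` and misses
    -- everything newer than `b`, which again gives a ladder.
    ...   | zs , zs⊆ys , inj₁ (len′ , hom) with initLast zs
    ...     | us ∷ʳ′ o =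
      no-long-ladder ladders (λ b _ → F o b) us
        (≤-pred (≤-trans len′ (≤-reflexive (trans (length-++ us) (+-comm (length us) 1)))))
        (λ s → avoid (⊆-trans (with-oldest (⊆-trans (refl ∷ refl ∷ _ ∷ʳ []) s)) (⊆-trans zs⊆ys ys⊆xs)))
        λ {b} {c} {y} s → does-true (E? (F o b) y)
          (hom (b ∷ y ∷ o ∷ []) (with-oldest (⊆-trans (refl ∷ c ∷ʳ refl ∷ []) s)))
      where
      with-oldest : ∀ {a b} → a ∷ b ∷ [] ⊆ us → a ∷ b ∷ o ∷ [] ⊆ us ++ o ∷ []
      with-oldest s = ++⁺ s ⊆-refl

  -- Covering a clique by boundedly many sets

  module Cover {K : Fin n → Set} (K? : Decidable K) {r : Fin n} (Kr : K r)
    {Good : Fin m → Set} (F : Fin n → Fin n → Fin m)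
    (F-good : ∀ {x y} → K x → K y → Good (F x y) × E (F x y) x × E (F x y) y) where

    open Generic F

    Covers : ∀ {N} → (Fin N → Fin n) → Set
    Covers v = ∀ x → K x → ∃₂ λ a b → E (F (v a) (v b)) x

    -- As long as some element of `K` escapes the sets of all chosen pairs, it becomes the newest
    -- one. It differs from each older `x` because `F x x` contains `x`. Once `K` is covered, `r`
    -- serves as padding.
    greedy : ∀ N → Σ (Fin N → Fin n) λ v → (∀ a → K (v a)) ×
      (Avoiding (tabulate v) × Distinct (tabulate v) ⊎ Covers v)
    greedy zero    = (λ ()) , (λ ()) , inj₁ ((λ ()) , (λ ()))
    greedy (suc N) with greedy N
    ... | v , Kv , inj₂ covers =
      (r Vector.∷ v) , (λ { zero → Kr ; (suc a) → Kv a }) ,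
      inj₂ λ x Kx → let (a , b , e) = covers x Kx in suc a , suc b , e
    ... | v , Kv , inj₁ (avoid , distinct)
      with any? (λ z → K? z ×-dec ¬? (any? λ a → any? λ b → E? (F (v a) (v b)) z))
    ...   | no none =
      (r Vector.∷ v) , (λ { zero → Kr ; (suc a) → Kv a }) ,
      inj₂ λ x Kx → let (a , b , e) = decidable-stable (any? λ a → any? λ b → E? (F (v a) (v b)) x)
                                         (λ ¬cov → none (x , Kx , ¬cov))
                    in suc a , suc b , e
    ...   | yes (z , Kz , fresh) =
      (z Vector.∷ v) , (λ { zero → Kz ; (suc a) → Kv a }) , inj₁ (avoid′ , distinct′)
      where
      fresh′ : ∀ {x y} → x ∈ tabulate v → y ∈ tabulate v → ¬ E (F x y) z
      fresh′ x∈ y∈ e with ∈-tabulate⁻ {f = v} x∈ | ∈-tabulate⁻ {f = v} y∈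
      ... | a , refl | b , refl = fresh (a , b , e)
      avoid′ : Avoiding (z ∷ tabulate v)
      avoid′ (_ ∷ʳ s)   = avoid s
      avoid′ (refl ∷ s) = fresh′ (to∈ (⊆-trans (_ ∷ʳ ⊆-refl) s)) (to∈ s)
      distinct′ : Distinct (z ∷ tabulate v)
      distinct′ (_ ∷ʳ s) = distinct s
      distinct′ (refl ∷ s) refl with ∈-tabulate⁻ {f = v} (to∈ s)
      ... | a , refl = fresh (a , a , proj₁ (proj₂ (F-good (Kv a) (Kv a))))

    -- At length `genericLength` the greedy choice cannot still be generic, so the sets of its pairs
    -- cover `K`. The map `p` turns the cover into a partition.
    cover : ∀ {ℓ h} → LadderBound (λ _ → ⊤) ℓ → ShatteredBound h →
      Σ (Fin n → Fin (coverSize ℓ h)) λ p → Σ (Fin (coverSize ℓ h) → Fin m) λ J →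
        (∀ c → Good (J c)) × (∀ x → K x → E (J (p x)) x)
    cover {ℓ} {h} ladders shatters with greedy (genericLength ℓ h)
    ... | v , Kv , inj₁ (avoid , distinct) =
      contradiction (≤-reflexive (sym (length-tabulate v)))
        (generic-short ladders shatters (tabulate v) avoid distinct inside)
      where
      inside : ∀ {x y} → x ∈ tabulate v → y ∈ tabulate v → E (F x y) x × E (F x y) y
      inside x∈ y∈ with ∈-tabulate⁻ {f = v} x∈ | ∈-tabulate⁻ {f = v} y∈
      ... | a , refl | b , refl = proj₂ (F-good (Kv a) (Kv b))
    ... | v , Kv , inj₂ covers = p , J , (λ c → proj₁ (F-good (Kv _) (Kv _))) , p-covers
      where
      J : Fin (coverSize ℓ h) → Fin m
      J c = uncurry (λ a b → F (v a) (v b)) (remQuot (genericLength ℓ h) c)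
      index : ∀ x → K x → Fin (coverSize ℓ h)
      index x Kx = combine (proj₁ (covers x Kx)) (proj₁ (proj₂ (covers x Kx)))
      index-covers : ∀ x (Kx : K x) → E (J (index x Kx)) x
      index-covers x Kx = subst (λ (a , b) → E (F (v a) (v b)) x)
        (sym (remQuot-combine (proj₁ (covers x Kx)) _)) (proj₂ (proj₂ (covers x Kx)))
      p : Fin n → Fin (coverSize ℓ h)
      p x with K? x
      ... | yes Kx = index x Kx
      -- Outside `K` any index will do; `r` supplies one.
      ... | no _   = index r Kr
      p-covers : ∀ x → K x → E (J (p x)) x
      p-covers x Kx with K? x
      ... | yes Kx′ = index-covers x Kx′
      ... | no ¬Kx  = contradiction Kx ¬Kx

  -- Oddness is required only for the colour of an element `x` of the set, so colours absent from
  -- the set need no separate case.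
  OddColouring : {W : Fin n → Set} → Decidable W → ℕ → Set
  OddColouring {W} W? c = Σ (Fin n → Fin c) λ φ → ∀ j x → W x → E j x →
    Odd (λ y → W? y ×-dec (E? j y ×-dec (φ y ≟ φ x)))

  -- Every set contains all of `W`, so only the parity of `W` matters. Under equality the classes
  -- are single elements, and splitting a single colour removes one of them if `W` is even.
  full-colouring : ∀ {W} (W? : Decidable W) → (∀ j x → W x → E j x) → OddColouring W? 2
  full-colouring {W} W? full = σ , λ j x Wx _ →
    Odd-resp (λ y → W? y ×-dec ((χ y ≟ χ x) ×-dec (σ y ≟ σ x))) _
      (λ y (Wy , _ , e) → Wy , full j y Wy , e) (λ y (Wy , _ , e) → Wy , refl , e)
      (proj₂ (proj₂ split) x Wx)
    where
    open Classes {R = _≡_} _≟_ refl sym trans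
    χ : Fin n → Fin 1
    χ _ = zero
    split = splitColours W? χ λ x Wx →
      Odd-singleton (λ y → W? y ×-dec ((χ y ≟ χ x) ×-dec (x ≟ y))) x (Wx , refl , refl) λ y (_ , _ , e) → sym e
    σ : Fin n → Fin 2
    σ = proj₁ split

  -- The induction step

  module Step {L h s g ℓ : ℕ} (ladders : LadderBound (λ _ → ⊤) L) (shatters : ShatteredBound h)
    (clusters : ClusterBound s) {W : Fin n → Set} (W? : Decidable W) (bound : LadderBound W (suc ℓ))
    (colour-smaller : ∀ {V} (V? : Decidable V) → LadderBound V ℓ → OddColouring V? g) where

    M : ℕ
    M = coverSize L h

    Proper : Fin m → Set
    Proper j = ∃ λ u → W u × ¬ E j u

    Proper? : Decidable Proper
    Proper? j = any? λ u → W? u ×-dec ¬? (E? j u)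

    κ : Fin n → Fin s
    κ = proj₁ (clusters W? Proper?)

    Adjacent : Fin n → Fin n → Set
    Adjacent x y = ∃ λ j → Proper j × E j x × E j y

    Adjacent? : ∀ x y → Dec (Adjacent x y)
    Adjacent? x y = any? λ j → Proper? j ×-dec (E? j x ×-dec E? j y)

    Adjacent-sym : ∀ {x y} → Adjacent x y → Adjacent y x
    Adjacent-sym (j , pj , ex , ey) = j , pj , ey , ex

    -- The classes are the cliques of the subcolouring. Equality is added because adjacency is not
    -- reflexive at elements in no proper set; these, and elements outside `W`, become singleton
    -- classes.
    R : Fin n → Fin n → Set
    R x y = x ≡ y ⊎ W x × W y × κ x ≡ κ y × Adjacent x y

    R? : ∀ x y → Dec (R x y)
    R? x y = (x ≟ y) ⊎-dec (W? x ×-dec (W? y ×-dec ((κ x ≟ κ y) ×-dec Adjacent? x y)))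

    R-sym : ∀ {x y} → R x y → R y x
    R-sym (inj₁ refl)              = inj₁ refl
    R-sym (inj₂ (Wx , Wy , e , a)) = inj₂ (Wy , Wx , sym e , Adjacent-sym a)

    R-trans : ∀ {x y z} → R x y → R y z → R x z
    R-trans (inj₁ refl)              r                        = r
    R-trans (inj₂ r)                 (inj₁ refl)              = inj₂ r
    R-trans (inj₂ (Wx , Wy , e , a)) (inj₂ (_ , Wz , e′ , a′)) =
      inj₂ (Wx , Wz , trans e e′ , proj₂ (clusters W? Proper?) Wx Wy Wz e e′ a a′)

    R-κ : ∀ {x y} → R x y → κ x ≡ κ y
    R-κ (inj₁ refl)            = refl
    R-κ (inj₂ (_ , _ , e , _)) = e

    R-W : ∀ {x y} → W x → R x y → W y
    R-W Wx (inj₁ refl)         = Wx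
    R-W Wx (inj₂ (_ , Wy , _)) = Wy

    open Classes R? (inj₁ refl) R-sym R-trans

    -- The second condition, on the clique as a whole, is what the later splitting of even colours
    -- relies on.
    CliqueColouring : Fin n → Set
    CliqueColouring r = Σ (Fin n → Fin (suc (M * g))) λ ψ →
      (∀ j x → R r x → E j x → Odd (λ y → R? r y ×-dec (E? j y ×-dec (ψ y ≟ ψ x)))) ×
      (∀ x → R r x → Odd (λ y → R? r y ×-dec (ψ y ≟ ψ x)))

    isolated-colouring : ∀ r → (∀ y → R r y → y ≡ r) → CliqueColouring r
    isolated-colouring r only = (λ _ → zero) ,
      (λ j x Rx Ex → Odd-singleton _ x (Rx , Ex , refl) λ y (Ry , _) → unique Ry Rx) ,
      (λ x Rx → Odd-singleton _ x (Rx , refl) λ y (Ry , _) → unique Ry Rx)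
      where
      unique : ∀ {x y} → R r y → R r x → y ≡ x
      unique Ry Rx = trans (only _ Ry) (sym (only _ Rx))

    -- Each part of the cover lies in a proper set, so the induction hypothesis colours it;
    -- different parts receive disjoint palettes.
    clique-colouring : ∀ r → CliqueColouring r
    clique-colouring r with W? r ×-dec Adjacent? r r
    ... | no ¬a = isolated-colouring r λ
            { y (inj₁ refl) → refl
            ; y (inj₂ (Wr , _ , _ , j , pj , er , _)) → contradiction (Wr , j , pj , er , er) ¬a }
    ... | yes (Wr , a@(j₀ , _)) = ψ , within , whole
      where
      choose : ∀ {x y} → Dec (Adjacent x y) → Fin m
      choose (yes (j , _)) = j
      choose (no _)        = j₀
      choose-good : ∀ {x y} → Adjacent x y → (d : Dec (Adjacent x y)) →
        Proper (choose d) × E (choose d) x × E (choose d) y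
      choose-good _ (yes (j , good)) = good
      choose-good a (no ¬a)          = contradiction a ¬a
      -- If `x` and `y` coincide, a proper set through `x` is still needed: the one shared with `r`,
      -- or `a` when `x` is `r`.
      adjacent : ∀ {x y} → R r x → R r y → Adjacent x y
      adjacent Rx Ry with R-trans (R-sym Rx) Ry
      adjacent Rx                                    Ry | inj₂ (_ , _ , _ , a) = a
      adjacent (inj₁ refl)                           Ry | inj₁ refl = a
      adjacent (inj₂ (_ , _ , _ , j , pj , _ , ex)) Ry | inj₁ refl = j , pj , ex , ex
      open Cover (R? r) {r} (inj₁ refl) {Proper} (λ x y → choose (Adjacent? x y))
        (λ {x} {y} Rx Ry → choose-good (adjacent Rx Ry) (Adjacent? x y))
      covering = cover ladders shatters
      p : Fin n → Fin M
      p = proj₁ covering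
      J : Fin M → Fin m
      J = proj₁ (proj₂ covering)
      J-proper : ∀ c → Proper (J c)
      J-proper = proj₁ (proj₂ (proj₂ covering))
      J-covers : ∀ x → R r x → E (J (p x)) x
      J-covers = proj₂ (proj₂ (proj₂ covering))
      part? : ∀ c → Decidable (λ y → R r y × p y ≡ c)
      part? c y = R? r y ×-dec (p y ≟ c)
      -- The set J c, which contains the part, extends any ladder in the part by one rung.
      part-bound : ∀ c → LadderBound (λ y → R r y × p y ≡ c) ℓ
      part-bound c K inK (outs , inns) with J-proper c
      ... | u , Wu , u∉ = ≤-pred (bound ((u , J c) ∷ K)
              (Wu ∷ All.map (λ (Ry , _) → R-W Wr Ry) inK)
              (u∉ ∷ outs , All.map (λ { {y , _} (Ry , refl) → J-covers y Ry }) inK ∷ inns))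
      φ : Fin M → Fin n → Fin g
      φ c = proj₁ (colour-smaller (part? c) (part-bound c))
      φ-odd : ∀ c j x → R r x × p x ≡ c → E j x →
        Odd (λ y → part? c y ×-dec (E? j y ×-dec (φ c y ≟ φ c x)))
      φ-odd c = proj₂ (colour-smaller (part? c) (part-bound c))
      ψ : Fin n → Fin (suc (M * g))
      ψ x = suc (combine (p x) (φ (p x) x))
      ψ-injective : ∀ {x y} → ψ y ≡ ψ x → p y ≡ p x × φ (p y) y ≡ φ (p x) x
      ψ-injective {x} {y} = combine-injective (p y) (φ (p y) y) (p x) (φ (p x) x) ∘ suc-injective
      ψ-cong : ∀ {x y} → p y ≡ p x → φ (p x) y ≡ φ (p x) x → ψ y ≡ ψ x
      ψ-cong {x} {y} e e′ =
        cong suc (cong₂ combine e (trans (cong (λ c → φ c y) e) e′))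
      within : ∀ j x → R r x → E j x → Odd (λ y → R? r y ×-dec (E? j y ×-dec (ψ y ≟ ψ x)))
      within j x Rx Ex =
        Odd-resp (λ y → part? (p x) y ×-dec (E? j y ×-dec (φ (p x) y ≟ φ (p x) x))) _
          (λ y ((Ry , e) , Ey , e′) → Ry , Ey , ψ-cong e e′)
          (λ y (Ry , Ey , eq) → let (e , e′) = ψ-injective eq in
            (Ry , e) , Ey , trans (cong (λ c → φ c y) (sym e)) e′)
          (φ-odd (p x) j x (Rx , refl) Ex)
      -- A colour of `ψ` stays in one part and hence inside one covering set, so its oddness in that
      -- set is its oddness in the clique.
      whole : ∀ x → R r x → Odd (λ y → R? r y ×-dec (ψ y ≟ ψ x))
      whole x Rx =
        Odd-resp (λ y → R? r y ×-dec (E? (J (p x)) y ×-dec (ψ y ≟ ψ x))) _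
          (λ y (Ry , _ , eq) → Ry , eq)
          (λ y (Ry , eq) → Ry , subst (λ c → E (J c) y) (proj₁ (ψ-injective eq)) (J-covers y Ry) , eq)
          (within (J (p x)) x Rx (J-covers x Rx))

    ψ : Fin n → Fin n → Fin (suc (M * g))
    ψ r = proj₁ (clique-colouring r)

    -- Going through `rep` makes all elements of a clique use the same clique colouring.
    χ : Fin n → Fin (s * suc (M * g))
    χ x = combine (κ x) (ψ (rep x) x)

    χ-injective : ∀ {x y} → χ y ≡ χ x → κ y ≡ κ x × ψ (rep y) y ≡ ψ (rep x) x
    χ-injective {x} {y} = combine-injective (κ y) (ψ (rep y) y) (κ x) (ψ (rep x) x)

    χ-cong : ∀ {x y} → R x y → ψ (rep x) y ≡ ψ (rep x) x → χ y ≡ χ x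
    χ-cong {x} {y} r e =
      cong₂ combine (sym (R-κ r)) (trans (cong (λ q → ψ q y) (sym (rep-cong r))) e)

    χ-clique : ∀ {x y} → R x y → χ y ≡ χ x → ψ (rep x) y ≡ ψ (rep x) x
    χ-clique {x} {y} r e = trans (cong (λ q → ψ q y) (rep-cong r)) (proj₂ (χ-injective e))

    from-rep : ∀ {x y} → R (rep x) y → R x y
    from-rep {x} = R-trans (rep-related x)

    to-rep : ∀ {x y} → R x y → R (rep x) y
    to-rep {x} = R-trans (R-sym (rep-related x))

    odd-class : ∀ x → W x → Odd (λ y → W? y ×-dec ((χ y ≟ χ x) ×-dec R? x y))
    odd-class x Wx = Odd-resp (λ y → R? (rep x) y ×-dec (ψ (rep x) y ≟ ψ (rep x) x)) _
      (λ y (Ry , e) → R-W Wx (from-rep Ry) , χ-cong (from-rep Ry) e , from-rep Ry)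
      (λ y (_ , e , Ry) → to-rep Ry , χ-clique Ry e)
      (proj₂ (proj₂ (clique-colouring (rep x))) x (to-rep (inj₁ refl)))

    split = splitColours W? χ odd-class

    σ : Fin n → Fin 2
    σ = proj₁ split

    colouring : OddColouring W? (s * suc (M * g) * 2)
    colouring = (λ x → combine (χ x) (σ x)) , λ j x Wx Ex → by-size j x Wx Ex (Proper? j)
      where
      by-size : ∀ j x → W x → E j x → Dec (Proper j) →
        Odd (λ y → W? y ×-dec (E? j y ×-dec (combine (χ y) (σ y) ≟ combine (χ x) (σ x))))
      -- Elements of a proper set with equal `κ` are adjacent, so each colour meets the set within
      -- one clique, where `σ` does not separate equal `χ`.
      by-size j x Wx Ex (yes pj) =
        Odd-resp (λ y → R? (rep x) y ×-dec (E? j y ×-dec (ψ (rep x) y ≟ ψ (rep x) x))) _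
          (λ y (Ry , Ey , e) → let eχ = χ-cong (from-rep Ry) e in
            R-W Wx (from-rep Ry) , Ey ,
            cong₂ combine eχ (sym (proj₁ (proj₂ split) (sym eχ) (from-rep Ry))))
          (λ y (Wy , Ey , e) →
            let eχ = proj₁ (combine-injective (χ y) (σ y) (χ x) (σ x) e)
                Ry = inj₂ (Wx , Wy , sym (proj₁ (χ-injective eχ)) , j , pj , Ex , Ey)
            in to-rep Ry , Ey , χ-clique Ry eχ)
          (proj₁ (proj₂ (clique-colouring (rep x))) j x (to-rep (inj₁ refl)) Ex)
      -- The set contains all of `W`, and every colour is odd on `W` after the splitting.
      by-size j x Wx Ex (no ¬pj) =
        Odd-resp (λ y → W? y ×-dec ((χ y ≟ χ x) ×-dec (σ y ≟ σ x))) _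
          (λ y (Wy , e , e′) → Wy , decidable-stable (E? j y) (λ y∉ → ¬pj (y , Wy , y∉)) , cong₂ combine e e′)
          (λ y (Wy , _ , e) → Wy , combine-injective (χ y) (σ y) (χ x) (σ x) e)
          (proj₂ (proj₂ split) x Wx)

  -- The index bound `L` of the whole system stays fixed, and with it the size of the covers, while
  -- `ℓ` decreases. At `ℓ = 0` an element of `W` missing from a set would already be a ladder of
  -- order one.
  odd-colouring : ∀ {L h s} → LadderBound (λ _ → ⊤) L → ShatteredBound h → ClusterBound s →
    ∀ ℓ {W} (W? : Decidable W) → LadderBound W ℓ → OddColouring W? (palette (coverSize L h) s ℓ)
  odd-colouring ladders shatters clusters zero W? bound = full-colouring W? λ j x Wx →
    decidable-stable (E? j x) λ x∉ → 1+n≰n (bound ((x , j) ∷ []) (Wx ∷ []) (x∉ ∷ [] , [] ∷ []))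
  odd-colouring ladders shatters clusters (suc ℓ) W? bound =
    Step.colouring ladders shatters clusters W? bound (odd-colouring ladders shatters clusters ℓ)

-- Translation to subsets

AllPairs-lookup : ∀ {A : Set} {R : A → A → Set} {xs} → AllPairs R xs →
  ∀ i j → i <ᶠ j → R (lookup xs i) (lookup xs j)
AllPairs-lookup (rs ∷ ps) zero    (suc j) _         = All.lookup rs (∈-lookup j)
AllPairs-lookup (rs ∷ ps) (suc i) (suc j) (s≤s i<j) = AllPairs-lookup ps i j i<j

opposite-antitone : ∀ {n} {i j : Fin n} → i <ᶠ j → opposite j <ᶠ opposite i
opposite-antitone {n} {i} {j} i<j
  rewrite opposite-prop i | opposite-prop j = ∸-monoʳ-< (s≤s i<j) (toℕ<n j)

subset : ∀ {n} {P : Fin n → Set} → Decidable P → Subset n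
subset P? = Vec.tabulate (does ∘ P?)

∈-subset⁺ : ∀ {n} {P : Fin n → Set} (P? : Decidable P) {x} → P x → x ∈ˢ subset P?
∈-subset⁺ P? {x} Px = lookup⇒[]= x _ (trans (lookup∘tabulate _ x) (dec-true (P? x) Px))

∈-subset⁻ : ∀ {n} {P : Fin n → Set} (P? : Decidable P) {x} → x ∈ˢ subset P? → P x
∈-subset⁻ P? {x} x∈ = does-true (P? x) (trans (sym (lookup∘tabulate _ x)) ([]=⇒lookup x∈))

colourClass-subset : ∀ {n c} (φ : Fin n → Fin c) i → colourClass φ i ≡ subset (λ x → φ x ≟ i)
colourClass-subset φ i = tabulate-cong λ x → isYes≗does (φ x ≟ i)

∈-colourClass⁺ : ∀ {n c} (φ : Fin n → Fin c) {i x} → φ x ≡ i → x ∈ˢ colourClass φ i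
∈-colourClass⁺ φ {i} e rewrite colourClass-subset φ i = ∈-subset⁺ (λ x → φ x ≟ i) e

∈-colourClass⁻ : ∀ {n c} (φ : Fin n → Fin c) {i x} → x ∈ˢ colourClass φ i → φ x ≡ i
∈-colourClass⁻ φ {i} x∈ rewrite colourClass-subset φ i = ∈-subset⁻ (λ x → φ x ≟ i) x∈

fromList : ∀ {n} → List (Fin n) → Subset n
fromList []       = ∅
fromList (x ∷ xs) = ⁅ x ⁆ ∪ fromList xs

∈-fromList⁺ : ∀ {n} {x : Fin n} {xs} → x ∈ xs → x ∈ˢ fromList xs
∈-fromList⁺ (here refl) = x∈p∪q⁺ (inj₁ (x∈⁅x⁆ _))
∈-fromList⁺ (there x∈)  = x∈p∪q⁺ (inj₂ (∈-fromList⁺ x∈))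

∈-fromList⁻ : ∀ {n} {x : Fin n} xs → x ∈ˢ fromList xs → x ∈ xs
∈-fromList⁻ []       x∈ = contradiction x∈ ∉⊥
∈-fromList⁻ (y ∷ xs) x∈ with x∈p∪q⁻ ⁅ y ⁆ (fromList xs) x∈
... | inj₁ x∈y = here (x∈⁅y⁆⇒x≡y y x∈y)
... | inj₂ x∈′ = there (∈-fromList⁻ xs x∈′)

length≤∣fromList∣ : ∀ {n} (xs : List (Fin n)) → Unique xs → length xs ≤ ∣ fromList xs ∣
length≤∣fromList∣ []       _             = z≤n
length≤∣fromList∣ (x ∷ xs) (x∉ ∷ unique) = ≤-trans (s≤s (length≤∣fromList∣ xs unique))
  (p⊂q⇒∣p∣<∣q∣ ((λ y∈ → x∈p∪q⁺ (inj₂ y∈)) , x , x∈p∪q⁺ (inj₁ (x∈⁅x⁆ x)) ,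
                λ x∈ → All.lookup x∉ (∈-fromList⁻ xs x∈) refl))

bit : Bool → ℕ
bit b = if b then 1 else 0

suc-%2 : ∀ k b → k % 2 ≡ bit b → suc k % 2 ≡ bit (not b)
suc-%2 zero          false _  = refl
suc-%2 (suc zero)    true  _  = refl
suc-%2 (suc (suc k)) b     eq = suc-%2 k b eq

card-parity : ∀ {n} (p : Subset n) → ∣ p ∣ % 2 ≡ bit (parity (Vec.lookup p))
card-parity []          = refl
card-parity (true ∷ p)  = suc-%2 ∣ p ∣ _ (card-parity p)
card-parity (false ∷ p) = card-parity p

Odd⇒odd-card : ∀ {n} (p : Subset n) → Odd (_∈? p) → ∣ p ∣ % 2 ≡ 1
Odd⇒odd-card p (odd o) = trans (card-parity p) (cong bit (trans (parity-cong lookup≗does) o))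
  where
  lookup≗does : ∀ x → Vec.lookup p x ≡ does (x ∈? p)
  lookup≗does x with x ∈? p
  ... | yes x∈ = []=⇒lookup x∈
  ... | no x∉  = ¬-not (x∉ ∘ lookup⇒[]= x p)

module _ (S : SetSystem) where

  open System {E = λ j x → x ∈ˢ sets S j} (λ j x → x ∈? sets S j)

  ladderBound : ∀ {ℓ} → SemiLadderIndexAtMost S ℓ → LadderBound (λ _ → ⊤) ℓ
  ladderBound index L _ (outs , inns) = index (length L)
    -- `Ladder` lists the rungs backwards, hence the reversed indices.
    (λ i → proj₁ (lookup L (opposite i))) (λ i → proj₂ (lookup L (opposite i)))
    ( (λ i → All.lookup outs (∈-lookup (opposite i)))
    , λ i j i<j → AllPairs-lookup inns (opposite j) (opposite i) (opposite-antitone i<j))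

  shatteredBound : ∀ {h} → TwoVCAtMost S h → ShatteredBound h
  shatteredBound vc xs unique shattered = ≤-trans (length≤∣fromList∣ xs unique) (vc (fromList xs) two-shattered)
    where
    two-shattered : TwoShattered S (fromList xs)
    two-shattered x y x∈ y∈ x≢y with shattered (∈-fromList⁻ xs x∈) (∈-fromList⁻ xs y∈) x≢y
    ... | j , x∈j , y∈j , only = j , λ z →
      (λ z∈ → let (z∈j , z∈X) = x∈p∩q⁻ (sets S j) (fromList xs) z∈ in only (∈-fromList⁻ xs z∈X) z∈j) ,
      λ { (inj₁ refl) → x∈p∩q⁺ (x∈j , x∈) ; (inj₂ refl) → x∈p∩q⁺ (y∈j , y∈) }

  clusterBound : ∀ {s} → HereditarySubchromaticAtMost S s → ClusterBound s
  clusterBound subchromatic {W} {Q} W? Q? with subchromatic (subset W?) (subset Q?)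
  ... | κ , cluster = κ , transitive
    where
    G : Graph (n S)
    G = GaifmanInduced S (subset W?) (subset Q?)
    Adjacent : Fin (n S) → Fin (n S) → Set
    Adjacent x y = ∃ λ j → Q j × x ∈ˢ sets S j × y ∈ˢ sets S j
    vertex : ∀ {x i} → W x → κ x ≡ i → x ∈ˢ V (induced G (colourClass κ i))
    vertex Wx e = x∈p∩q⁺ (∈-subset⁺ W? Wx , ∈-colourClass⁺ κ e)
    edge : ∀ {x y} → W x → W y → x ≢ y → Adjacent x y → Adj G x y
    edge Wx Wy x≢y (j , Qj , x∈ , y∈) = x≢y , j , ∈-subset⁺ Q? Qj ,
      x∈p∩q⁺ (x∈ , ∈-subset⁺ W? Wx) , x∈p∩q⁺ (y∈ , ∈-subset⁺ W? Wy)
    transitive : ∀ {x y z} → W x → W y → W z → κ x ≡ κ y → κ y ≡ κ z →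
      Adjacent x y → Adjacent y z → Adjacent x z
    -- Coinciding elements are treated apart, since the Gaifman graph has no loops.
    transitive {x} {y} {z} Wx Wy Wz e e′ a@(j , Qj , x∈ , _) a′ with x ≟ y | y ≟ z | x ≟ z
    ... | yes refl | _        | _        = a′
    ... | _        | yes refl | _        = a
    ... | _        | _        | yes refl = j , Qj , x∈ , x∈
    ... | no x≢y   | no y≢z   | no x≢z
      -- The path through `y` puts `x` and `z` into one component of their colour class, which is a
      -- clique.
      with cluster (κ z) x z (step (vertex Wx (trans e e′)) (edge Wx Wy x≢y a)
             (step (vertex Wy e′) (edge Wy Wz y≢z a′) (here (vertex Wz refl)))) x≢z
    ...   | _ , k , k∈ , x∈k , z∈k = k , ∈-subset⁻ Q? k∈ ,
      proj₁ (x∈p∩q⁻ (sets S k) _ x∈k) , proj₁ (x∈p∩q⁻ (sets S k) _ z∈k)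

  strongOdd : ∀ {c} → OddColouring {λ _ → ⊤} (λ _ → yes tt) c → StrongOddChromaticAtMost S c
  strongOdd (φ , φ-odd) = φ , λ j i → by-emptiness j i (nonempty? (sets S j ∩ colourClass φ i))
    where
    by-emptiness : ∀ j i → Dec (Nonempty (sets S j ∩ colourClass φ i)) →
      ∣ sets S j ∩ colourClass φ i ∣ ≡ 0 ⊎ ∣ sets S j ∩ colourClass φ i ∣ % 2 ≡ 1
    by-emptiness j i (no empty) = inj₁ (trans (cong ∣_∣ (Empty-unique empty)) (∣⊥∣≡0 (n S)))
    by-emptiness j i (yes (x , x∈)) with x∈p∩q⁻ (sets S j) (colourClass φ i) x∈
    ... | x∈j , x∈i with ∈-colourClass⁻ φ x∈i
    ...   | refl = inj₂ (Odd⇒odd-card _ (Odd-resp _ _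
              (λ y (_ , y∈j , e) → x∈p∩q⁺ (y∈j , ∈-colourClass⁺ φ e))
              (λ y y∈ → let (y∈j , y∈i) = x∈p∩q⁻ (sets S j) _ y∈ in tt , y∈j , ∈-colourClass⁻ φ y∈i)
              (φ-odd j x tt x∈j)))

theorem1p3 : Σ (ℕ → ℕ → ℕ → ℕ) λ f →
    ∀ (S : SetSystem) (ℓ h s : ℕ) →
    SemiLadderIndexAtMost S ℓ → TwoVCAtMost S h → HereditarySubchromaticAtMost S s →
    StrongOddChromaticAtMost S (f ℓ h s)
theorem1p3 = (λ ℓ h s → palette (coverSize ℓ h) s ℓ) , λ S ℓ h s index vc subchromatic →
  let open System {E = λ j x → x ∈ˢ sets S j} (λ j x → x ∈? sets S j)
      ladders = ladderBound S index
  -- The induction starts with `W` the whole universe, so `ladders` supplies both the fixed bound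
  -- and the initial value of the decreasing one.
  in strongOdd S (odd-colouring ladders (shatteredBound S vc) (clusterBound S subchromatic) ℓ
       (λ _ → yes tt) ladders)
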